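{- Let $G$ be a graph on $n$ vertices, and let $r \geq 1$ be a positive integer. Then $G$ contains a relatively $\frac{1}{r}$-full subgraph on $\lfloor \frac{n}{r} \rfloor$, $\lceil \frac{n}{r} \rceil$ or $\lceil \frac{n}{r} \rceil + 1$ vertices.
   Context: Graphs are finite and simple. For $q \in [0,1]$, a subgraph $H$ of a graph $G$ is relatively $q$-full if $d_H(v) \geq q\, d_G(v)$ for all $v \in V(H)$, where $d_H(v)$ and $d_G(v)$ denote the degrees of $v$ in $H$ and $G$. (The empty subgraph on $0$ vertices satisfies this vacuously.) -}

module Defs where

open import Data.Fin.Base using (Fin)
open import Data.Fin.Subset using (Subset; _∈_; ∣_∣)
open import Data.Integer.Base using (+_)
open import Data.Nat.Base using (ℕ)
open import Data.Rational.Base using (ℚ; _/_; _*_; _≥_)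
open import Data.Vec.Base using (allFin; count)
open import Level using (0ℓ)
open import Relation.Binary.Core using (Rel)
open import Relation.Binary.Definitions using (Decidable; Irreflexive; Symmetric)
open import Relation.Binary.PropositionalEquality.Core using (_≡_)

-- Finite simple graphs with vertex set Fin n. Adjacency is decidable so that
-- degrees are computable.
record Graph (n : ℕ) : Set₁ where
  field
    Adj    : Rel (Fin n) 0ℓ
    adj?   : Decidable Adj
    sym    : Symmetric Adj
    irrefl : Irreflexive _≡_ Adj

  degree : Fin n → ℕ
  degree v = count (adj? v) (allFin n)

-- Subgraphs are arbitrary: neither induced nor spanning in general.
record Subgraph {n : ℕ} (G : Graph n) : Set₁ where
  open Graph G using (Adj)
  field
    vertices : Subset n
    Edge     : Rel (Fin n) 0ℓ
    edge?    : Decidable Edge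
    sym      : Symmetric Edge
    edge⇒∈   : ∀ {u v} → Edge u v → u ∈ vertices
    edge⇒adj : ∀ {u v} → Edge u v → Adj u v

  order : ℕ
  order = ∣ vertices ∣

  -- By edge⇒∈ and sym, only vertices of the subgraph are counted.
  degree : Fin n → ℕ
  degree v = count (edge? v) (allFin n)

RelativelyFull : ∀ {n} {G : Graph n} → ℚ → Subgraph G → Set
RelativelyFull {G = G} q H =
  ∀ {v} → v ∈ Subgraph.vertices H →
  + Subgraph.degree H v / 1 ≥ q * (+ Graph.degree G v / 1)

{-# OPTIONS --safe #-}
module Submission where

-- Colour the vertices with r colours so that, for c = ⌈n/r⌉, every class has
-- at most c vertices, except that one class may have c + 1. Some class A has c
-- or c + 1 vertices: the exceptional one, or one found by averaging. If A is
-- not 1/r-full, some v in A has fewer than d(v)/r neighbours in A, hence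
-- strictly more of them in some other class B. Moving v to B preserves the
-- size condition, with B as the exceptional class, and strictly increases the
-- number of monochromatic edges, so after finitely many moves some such A is
-- 1/r-full.

open import Defs
open import Algebra.Properties.Semiring.Sum as Summation using ()
open import Data.Bool.Base using (true; false; if_then_else_)
import Data.Bool.Properties as Bool
open import Data.Fin.Base using (Fin; zero; suc; punchIn)
open import Data.Fin.Properties using (_≟_; any?; punchInᵢ≢i)
open import Data.Fin.Subset using (Subset; _∈_; ∣_∣)
import Data.Integer.Base as ℤ
import Data.Integer.DivMod as ℤ
import Data.Integer.Properties as ℤ
import Data.Integer.Tactic.RingSolver as ℤSolver
open import Data.Nat.Base as ℕ using (ℕ; NonZero)
open import Data.Nat.GCD using (gcd)
open import Data.Nat.Properties hiding (_≟_)
open import Data.Nat.Solver using (module +-*-Solver)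
open import Data.Product.Base using (Σ-syntax; ∃-syntax; _×_; _,_; proj₁)
import Data.Rational.Base as ℚ
import Data.Rational.Properties as ℚ
import Data.Rational.Unnormalised.Base as ℚᵘ
import Data.Rational.Unnormalised.Properties as ℚᵘ
open import Data.Sum.Base as Sum using (_⊎_; inj₁; inj₂)
import Data.Vec.Base as Vec
open import Data.Vec.Functional as Vector using (Vector; removeAt; updateAt)
open import Data.Vec.Functional.Properties using (updateAt-updates; updateAt-minimal)
open import Data.Vec.Properties using (lookup∘tabulate; lookup⇒[]=; []=⇒lookup)
open import Function.Base using (const; id; _∘_)
open import Relation.Binary.PropositionalEquality
  using (_≡_; _≢_; refl; sym; trans; cong; cong₂; subst; subst₂; module ≡-Reasoning)
open import Relation.Nullary.Decidable using (Dec; yes; no; does; dec-true; dec-false; _×-dec_)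
open import Relation.Nullary.Negation using (¬_; contradiction)

module Recolouring where

  open import Data.Nat.Base
  open Summation +-*-semiring

  -- Indicators and finite sums of naturals.

  𝟙 : ∀ {p} {P : Set p} → Dec P → ℕ
  𝟙 P? = if does P? then 1 else 0

  𝟙-yes : ∀ {p} {P : Set p} (P? : Dec P) → P → 𝟙 P? ≡ 1
  𝟙-yes P? p rewrite dec-true P? p = refl

  𝟙-no : ∀ {p} {P : Set p} (P? : Dec P) → ¬ P → 𝟙 P? ≡ 0
  𝟙-no P? ¬p rewrite dec-false P? ¬p = refl

  𝟙-cong : ∀ {p q} {P : Set p} {Q : Set q} (P? : Dec P) (Q? : Dec Q) → (P → Q) → (Q → P) → 𝟙 P? ≡ 𝟙 Q?
  𝟙-cong (yes p) Q? to from = sym (𝟙-yes Q? (to p))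
  𝟙-cong (no ¬p) Q? to from = sym (𝟙-no Q? (¬p ∘ from))

  𝟙≤1 : ∀ {p} {P : Set p} (P? : Dec P) → 𝟙 P? ≤ 1
  𝟙≤1 (yes _) = ≤-refl
  𝟙≤1 (no _)  = z≤n

  sum-const : ∀ n c → ∑[ i < n ] c ≡ n * c
  sum-const zero    c = refl
  sum-const (suc n) c = cong (c +_) (sum-const n c)

  sum-mono-≤ : ∀ {n} (f g : Vector ℕ n) → (∀ i → f i ≤ g i) → sum f ≤ sum g
  sum-mono-≤ {zero}  f g f≤g = z≤n
  sum-mono-≤ {suc n} f g f≤g = +-mono-≤ (f≤g zero) (sum-mono-≤ (f ∘ suc) (g ∘ suc) (f≤g ∘ suc))

  -- Averaging: otherwise the sums would compare the other way. This yields the class with room, the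
  -- large class and the class with more neighbours.
  sum<⇒∃< : ∀ {n} (f g : Vector ℕ n) → sum f < sum g → ∃[ i ] f i < g i
  sum<⇒∃< f g ∑f<∑g with any? (λ i → f i <? g i)
  ... | yes found = found
  ... | no  ¬found = contradiction ∑f<∑g
    (≤⇒≯ (sum-mono-≤ g f λ i → ≮⇒≥ λ fi<gi → ¬found (i , fi<gi)))

  sum-𝟙-≟ : ∀ {r} (j : Fin r) → ∑[ i < r ] 𝟙 (j ≟ i) ≡ 1
  sum-𝟙-≟ {suc r} j = begin
    ∑[ i < suc r ] 𝟙 (j ≟ i)                      ≡⟨ sum-remove {i = j} (λ i → 𝟙 (j ≟ i)) ⟩
    𝟙 (j ≟ j) + ∑[ k < r ] 𝟙 (j ≟ punchIn j k)   ≡⟨ cong₂ _+_ (𝟙-yes (j ≟ j) refl)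
                                                       (sum-cong-≗ λ k → 𝟙-no (j ≟ punchIn j k) (punchInᵢ≢i j k ∘ sym)) ⟩
    1 + ∑[ k < r ] 0                              ≡⟨ cong suc (sum-const r 0) ⟩
    1 + r * 0                                     ≡⟨ cong suc (*-zeroʳ r) ⟩
    1                                             ∎
    where open ≡-Reasoning

  -- Colourings, class weights and recolouring one vertex.

  Colouring : ℕ → ℕ → Set
  Colouring n r = Vector (Fin r) n

  -- One formula for two counts: constant `g` equal to 1 gives class sizes, and an adjacency row
  -- gives the number of neighbours in each class.
  weight : ∀ {n r} → Colouring n r → Vector ℕ n → Vector ℕ r
  weight {n} f g i = ∑[ w < n ] (g w * 𝟙 (f w ≟ i))

  size : ∀ {n r} → Colouring n r → Vector ℕ r
  size f = weight f (const 1)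

  -- Double counting: after exchanging the sums, each vertex contributes to exactly one class.
  sum-weight : ∀ {n r} (f : Colouring n r) g → sum (weight f g) ≡ sum g
  sum-weight {n} {r} f g = begin
    ∑[ i < r ] ∑[ w < n ] (g w * 𝟙 (f w ≟ i))  ≡⟨ ∑-comm (λ i w → g w * 𝟙 (f w ≟ i)) ⟩
    ∑[ w < n ] ∑[ i < r ] (g w * 𝟙 (f w ≟ i))  ≡⟨ sum-cong-≗ (λ w → sym (*-distribˡ-sum (g w) (λ i → 𝟙 (f w ≟ i)))) ⟩
    ∑[ w < n ] (g w * ∑[ i < r ] 𝟙 (f w ≟ i))  ≡⟨ sum-cong-≗ (λ w → trans (cong (g w *_) (sum-𝟙-≟ (f w))) (*-identityʳ (g w))) ⟩
    sum g                                      ∎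
    where open ≡-Reasoning

  sum-size : ∀ {n r} (f : Colouring n r) → sum (size f) ≡ n
  sum-size {n} f = trans (sum-weight f (const 1)) (trans (sum-const n 1) (*-identityʳ n))

  recolour : ∀ {n r} → Colouring n r → Fin n → Fin r → Colouring n r
  recolour f v j = updateAt f v (const j)

  -- Only the term of `v` changes. Adding its old contribution on the left avoids subtraction and
  -- covers `i` equal to either colour, both or neither.
  weight-recolour : ∀ {n r} (f : Colouring n r) g v j i →
    weight (recolour f v j) g i + g v * 𝟙 (f v ≟ i) ≡ weight f g i + g v * 𝟙 (j ≟ i)
  weight-recolour {suc n} f g v j i = begin
    weight f′ g i + g v * 𝟙 (f v ≟ i)              ≡⟨ cong (_+ g v * 𝟙 (f v ≟ i)) (sum-remove {i = v} (term f′)) ⟩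
    term f′ v + rest f′ + g v * 𝟙 (f v ≟ i)        ≡⟨ cong (λ x → x + g v * 𝟙 (f v ≟ i))
                                                       (cong₂ _+_ (cong (λ c → g v * 𝟙 (c ≟ i)) (updateAt-updates v f)) rest-eq) ⟩
    g v * 𝟙 (j ≟ i) + rest f + g v * 𝟙 (f v ≟ i)   ≡⟨ solve 3 (λ x y z → x :+ y :+ z := z :+ y :+ x) refl (g v * 𝟙 (j ≟ i)) (rest f) (g v * 𝟙 (f v ≟ i)) ⟩
    term f v + rest f + g v * 𝟙 (j ≟ i)            ≡⟨ cong (_+ g v * 𝟙 (j ≟ i)) (sym (sum-remove {i = v} (term f))) ⟩
    weight f g i + g v * 𝟙 (j ≟ i)                 ∎
    where
    open ≡-Reasoning
    open +-*-Solver
    f′ = recolour f v j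
    term : Colouring (suc n) _ → Vector ℕ (suc n)
    term h w = g w * 𝟙 (h w ≟ i)
    rest : Colouring (suc n) _ → ℕ
    rest h = sum (removeAt (term h) v)
    rest-eq : rest f′ ≡ rest f
    rest-eq = sum-cong-≗ λ k → cong (λ c → g (punchIn v k) * 𝟙 (c ≟ i)) (updateAt-minimal _ _ f (punchInᵢ≢i v k))

  -- Twice the number of monochromatic edges when a is an adjacency matrix.
  energy : ∀ {n r} → (Fin n → Vector ℕ n) → Colouring n r → ℕ
  energy {n} a f = ∑[ u < n ] weight f (a u) (f u)

  -- Row `v` passes from its weight in the old class to that in class `j`, and by symmetry the other
  -- rows together change by the same amount; hence the factor 2. The zero diagonal keeps the colour
  -- of `v` out of its own row.
  energy-recolour : ∀ {n r} (a : Fin n → Vector ℕ n) (f : Colouring n r) v j →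
    (∀ u w → a u w ≡ a w u) → a v v ≡ 0 →
    energy a (recolour f v j) + 2 * weight f (a v) (f v) ≡ energy a f + 2 * weight f (a v) j
  energy-recolour {suc n} {r} a f v j a-sym avv≡0 = begin
    energy a f′ + 2 * D p                      ≡⟨ cong (_+ 2 * D p) (sum-remove {i = v} (λ u → weight f′ (a u) (f′ u))) ⟩
    weight f′ (a v) (f′ v) + rest f′ f′ + 2 * D p ≡⟨ cong (_+ 2 * D p) (cong₂ _+_ head-eq
                                                    (sum-cong-≗ λ k → cong (weight f′ (a (π k))) (f′π k))) ⟩
    D j + rest f′ f + 2 * D p                  ≡⟨ solve 3 (λ x y z → x :+ y :+ con 2 :* z := (y :+ z) :+ (x :+ z)) refl (D j) (rest f′ f) (D p) ⟩
    (rest f′ f + D p) + (D j + D p)            ≡⟨ cong (_+ (D j + D p)) rest-eq ⟩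
    (rest f f + D j) + (D j + D p)             ≡⟨ solve 3 (λ x y z → (y :+ x) :+ (x :+ z) := z :+ y :+ con 2 :* x) refl (D j) (rest f f) (D p) ⟩
    D p + rest f f + 2 * D j                   ≡⟨ cong (_+ 2 * D j) (sym (sum-remove {i = v} (λ u → weight f (a u) (f u)))) ⟩
    energy a f + 2 * D j                       ∎
    where
    open ≡-Reasoning
    open +-*-Solver
    f′ = recolour f v j
    p = f v
    π = punchIn v
    D : Fin r → ℕ
    D = weight f (a v)
    -- `h` is the colouring being counted and `h′` selects the class for each row; off `v`, `h′` can
    -- be reset to `f` at once, while `h` needs `rest-eq`.
    rest : (h h′ : Colouring (suc n) r) → ℕ
    rest h h′ = ∑[ k < n ] weight h (a (π k)) (h′ (π k))
    f′π : ∀ k → f′ (π k) ≡ f (π k)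
    f′π k = updateAt-minimal _ _ f (punchInᵢ≢i v k)
    head-eq : weight f′ (a v) (f′ v) ≡ D j
    head-eq = begin
      weight f′ (a v) (f′ v)               ≡⟨ cong (weight f′ (a v)) (updateAt-updates v f) ⟩
      weight f′ (a v) j                    ≡⟨ sym (+-identityʳ _) ⟩
      weight f′ (a v) j + 0                ≡⟨ cong (λ x → weight f′ (a v) j + x * 𝟙 (f v ≟ j)) (sym avv≡0) ⟩
      weight f′ (a v) j + a v v * 𝟙 (f v ≟ j) ≡⟨ weight-recolour f (a v) v j j ⟩
      D j + a v v * 𝟙 (j ≟ j)              ≡⟨ cong (λ x → D j + x * 𝟙 (j ≟ j)) avv≡0 ⟩
      D j + 0                              ≡⟨ +-identityʳ _ ⟩
      D j                                  ∎
    -- By symmetry column `v` is row `v`, and the omitted diagonal term is zero.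
    column : ∀ i → ∑[ k < n ] (a (π k) v * 𝟙 (i ≟ f (π k))) ≡ D i
    column i = begin
      ∑[ k < n ] (a (π k) v * 𝟙 (i ≟ f (π k)))  ≡⟨ sum-cong-≗ (λ k → cong₂ _*_ (a-sym (π k) v)
                                                     (𝟙-cong (i ≟ f (π k)) (f (π k) ≟ i) sym sym)) ⟩
      ∑[ k < n ] (a v (π k) * 𝟙 (f (π k) ≟ i))  ≡⟨ cong (λ x → x * 𝟙 (f v ≟ i) + ∑[ k < n ] (a v (π k) * 𝟙 (f (π k) ≟ i))) (sym avv≡0) ⟩
      a v v * 𝟙 (f v ≟ i) + ∑[ k < n ] (a v (π k) * 𝟙 (f (π k) ≟ i)) ≡⟨ sym (sum-remove {i = v} (λ w → a v w * 𝟙 (f w ≟ i))) ⟩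
      D i                                       ∎
    rest-eq : rest f′ f + D p ≡ rest f f + D j
    rest-eq = begin
      rest f′ f + D p ≡⟨ cong (rest f′ f +_) (sym (column p)) ⟩
      rest f′ f + ∑[ k < n ] (a (π k) v * 𝟙 (p ≟ f (π k))) ≡⟨ sym (∑-distrib-+ (λ k → weight f′ (a (π k)) (f (π k))) _) ⟩
      ∑[ k < n ] (weight f′ (a (π k)) (f (π k)) + a (π k) v * 𝟙 (p ≟ f (π k)))
        ≡⟨ sum-cong-≗ (λ k → weight-recolour f (a (π k)) v j (f (π k))) ⟩
      ∑[ k < n ] (weight f (a (π k)) (f (π k)) + a (π k) v * 𝟙 (j ≟ f (π k)))
        ≡⟨ ∑-distrib-+ (λ k → weight f (a (π k)) (f (π k))) _ ⟩
      rest f f + ∑[ k < n ] (a (π k) v * 𝟙 (j ≟ f (π k))) ≡⟨ cong (rest f f +_) (column j) ⟩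
      rest f f + D j ∎

  -- Bounds on class weights and class sizes.

  weight≤sum : ∀ {n r} (f : Colouring n r) g i → weight f g i ≤ sum g
  weight≤sum f g i = sum-mono-≤ _ g λ w →
    ≤-trans (*-monoʳ-≤ (g w) (𝟙≤1 (f w ≟ i))) (≤-reflexive (*-identityʳ (g w)))

  -- Class `p` is allowed the extra vertex but need not have it, so a colouring with all classes
  -- within `c` qualifies for every `p`.
  NearlyBounded : ∀ {n r} → ℕ → Colouring n r → Fin r → Set
  NearlyBounded c f p = size f p ≤ suc c × (∀ i → i ≢ p → size f i ≤ c)

  -- Greedy: a class with room remains as long as fewer than `r * c` vertices are coloured.
  boundedColouring : ∀ n r c → n ≤ r * c → Σ[ f ∈ Colouring n r ] (∀ i → size f i ≤ c)
  boundedColouring zero    r c _   = (λ ()) , λ _ → z≤n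
  boundedColouring (suc n) r c n<rc with boundedColouring n r c (<⇒≤ n<rc)
  ... | f , f≤c with sum<⇒∃< (size f) (const c) (subst₂ _<_ (sym (sum-size f)) (sym (sum-const r c)) n<rc)
  ...   | j , fj<c = j Vector.∷ f , bound
    where
    bound : ∀ i → 1 * 𝟙 (j ≟ i) + size f i ≤ c
    bound i with j ≟ i
    ... | yes refl = fj<c
    ... | no  _    = f≤c i

  -- The hypothesis `r * c < n + r` puts `c - 1` below the average class size, so some class reaches
  -- `c`. If `p` falls short, all classes are within `c` and any of them may be marked instead.
  largeClass : ∀ {n r} c (f : Colouring n r) p → r * c < n + r → NearlyBounded c f p →
    ∃[ q ] c ≤ size f q × NearlyBounded c f q
  largeClass {n} {r} c f p rc<n+r (fp≤1+c , f≤c) with c ≤? size f p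
  ... | yes c≤fp = p , c≤fp , fp≤1+c , f≤c
  -- Sizes are shifted by one, so that the strict inequality from averaging reads `c ≤ size f q`.
  ... | no  c≰fp with sum<⇒∃< (const c) (suc ∘ size f) (subst₂ _<_ (sym (sum-const r c)) (sym ∑≡n+r) rc<n+r)
    where
    ∑≡n+r : sum (suc ∘ size f) ≡ n + r
    ∑≡n+r = begin
      sum (suc ∘ size f)          ≡⟨ ∑-distrib-+ (const 1) (size f) ⟩
      ∑[ i < r ] 1 + sum (size f) ≡⟨ cong₂ _+_ (sum-const r 1) (sum-size f) ⟩
      r * 1 + n                   ≡⟨ cong (_+ n) (*-identityʳ r) ⟩
      r + n                       ≡⟨ +-comm r n ⟩
      n + r                       ∎
      where open ≡-Reasoning
  ...   | q , s≤s c≤fq = q , c≤fq , m≤n⇒m≤1+n (bound q) , λ i _ → bound i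
    where
    bound : ∀ i → size f i ≤ c
    bound i with i ≟ p
    ... | yes refl = <⇒≤ (≰⇒> c≰fp)
    ... | no  i≢p  = f≤c i i≢p

  -- The old class gives up a vertex and drops to at most `c`; class `j` had at most `c` and may
  -- take the extra one.
  nearlyBounded-recolour : ∀ {n r c} (f : Colouring n r) v j → j ≢ f v →
    NearlyBounded c f (f v) → NearlyBounded c (recolour f v j) j
  nearlyBounded-recolour {c = c} f v j j≢p (fp≤1+c , f≤c) = target , others
    where
    open ≤-Reasoning
    f′ = recolour f v j
    target : size f′ j ≤ suc c
    target = begin
      size f′ j                     ≤⟨ m≤m+n _ _ ⟩
      size f′ j + 1 * 𝟙 (f v ≟ j)   ≡⟨ weight-recolour f (const 1) v j j ⟩
      size f j + 1 * 𝟙 (j ≟ j)      ≤⟨ +-mono-≤ (f≤c j j≢p) (*-monoʳ-≤ 1 (𝟙≤1 (j ≟ j))) ⟩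
      c + 1                         ≡⟨ +-comm c 1 ⟩
      suc c                         ∎
    others : ∀ i → i ≢ j → size f′ i ≤ c
    others i i≢j with i ≟ f v
    ... | yes refl = s≤s⁻¹ (begin
      suc (size f′ i)               ≡⟨ +-comm 1 _ ⟩
      size f′ i + 1 * 1             ≡⟨ cong (λ x → size f′ i + 1 * x) (sym (𝟙-yes (f v ≟ i) refl)) ⟩
      size f′ i + 1 * 𝟙 (f v ≟ i)   ≡⟨ weight-recolour f (const 1) v j i ⟩
      size f i + 1 * 𝟙 (j ≟ i)      ≡⟨ cong (λ x → size f i + 1 * x) (𝟙-no (j ≟ i) (i≢j ∘ sym)) ⟩
      size f i + 0                  ≡⟨ +-identityʳ _ ⟩
      size f i                      ≤⟨ fp≤1+c ⟩
      suc c                         ∎)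
    ... | no  i≢p  = begin
      size f′ i                     ≤⟨ m≤m+n _ _ ⟩
      size f′ i + 1 * 𝟙 (f v ≟ i)   ≡⟨ weight-recolour f (const 1) v j i ⟩
      size f i + 1 * 𝟙 (j ≟ i)      ≡⟨ cong (λ x → size f i + 1 * x) (𝟙-no (j ≟ i) (i≢j ∘ sym)) ⟩
      size f i + 0                  ≡⟨ +-identityʳ _ ⟩
      size f i                      ≤⟨ f≤c i i≢p ⟩
      c                             ∎

  -- Local search for a full class.

  FullClass : ∀ {n r} → (Fin n → Vector ℕ n) → Colouring n r → Fin r → Set
  FullClass {r = r} a f p = ∀ v → f v ≡ p → sum (a v) ≤ r * weight f (a v) p

  module _ {n r : ℕ} (a : Fin n → Vector ℕ n) (a-sym : ∀ u w → a u w ≡ a w u) (a-irrefl : ∀ v → a v v ≡ 0) where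

    energy-bounded : (f : Colouring n r) → energy a f ≤ ∑[ u < n ] sum (a u)
    energy-bounded f = sum-mono-≤ _ (λ u → sum (a u)) λ u → weight≤sum f (a u) (f u)

    fullOrImprovable : ∀ {c} (f : Colouring n r) p → NearlyBounded c f p →
      FullClass a f p ⊎ Σ[ f′ ∈ Colouring n r ] ∃[ q ] NearlyBounded c f′ q × energy a f < energy a f′
    fullOrImprovable f p bounded
      with any? (λ v → (f v ≟ p) ×-dec (r * weight f (a v) p <? sum (a v)))
    ... | no  none = inj₁ λ v fv≡p → ≮⇒≥ λ defect → none (v , fv≡p , defect)
    ... | yes (v , refl , defect)
      -- The defect puts the weight of row `v` in its own class below the average over the `r`
      -- classes.
      with sum<⇒∃< (const (weight f (a v) p)) (weight f (a v))
             (subst₂ _<_ (sym (sum-const r _)) (sym (sum-weight f (a v))) defect)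
    ...   | j , Dp<Dj = inj₂ (recolour f v j , j , nearlyBounded-recolour f v j j≢p bounded , gain)
      where
      j≢p : j ≢ p
      j≢p refl = <-irrefl refl Dp<Dj
      gain : energy a f < energy a (recolour f v j)
      gain = +-cancelʳ-< _ _ _ (begin-strict
        energy a f + 2 * weight f (a v) p                 <⟨ +-monoʳ-< (energy a f) (*-monoʳ-< 2 Dp<Dj) ⟩
        energy a f + 2 * weight f (a v) j                 ≡⟨ sym (energy-recolour a f v j a-sym (a-irrefl v)) ⟩
        energy a (recolour f v j) + 2 * weight f (a v) p  ∎)
        where open ≤-Reasoning

    -- Recursion on `k`, a strict upper bound for the energy still to be gained: each move gains at
    -- least 1, and `k` zero would put the energy above its upper bound.
    improveToFull : ∀ c → r * c < n + r → ∀ k (f : Colouring n r) p → NearlyBounded c f p →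
      ∑[ u < n ] sum (a u) < energy a f + k →
      Σ[ f′ ∈ Colouring n r ] ∃[ q ] c ≤ size f′ q × size f′ q ≤ suc c × FullClass a f′ q
    improveToFull c rc<n+r zero f p _ B<e =
      contradiction (subst (_ <_) (+-identityʳ _) B<e) (≤⇒≯ (energy-bounded f))
    improveToFull c rc<n+r (suc k) f p bounded B<e+1+k
      -- The class marked by the last move can be smaller than `c`, so a large class is chosen
      -- before fullness is tested.
      with largeClass c f p rc<n+r bounded
    ... | q , c≤fq , bounded′ with fullOrImprovable f q bounded′
    ...   | inj₁ full = f , q , c≤fq , proj₁ bounded′ , full
    ...   | inj₂ (f′ , p′ , bounded″ , gain) = improveToFull c rc<n+r k f′ p′ bounded″ (begin-strict
      ∑[ u < n ] sum (a u)  <⟨ B<e+1+k ⟩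
      energy a f + suc k    ≡⟨ +-suc _ k ⟩
      suc (energy a f) + k  ≤⟨ +-monoˡ-≤ k gain ⟩
      energy a f′ + k       ∎)
      where open ≤-Reasoning

  existsFullClass : ∀ {n r} .{{_ : NonZero r}} (a : Fin n → Vector ℕ n) →
    (∀ u w → a u w ≡ a w u) → (∀ v → a v v ≡ 0) → ∀ c → n ≤ r * c → r * c < n + r →
    Σ[ f ∈ Colouring n r ] ∃[ p ] c ≤ size f p × size f p ≤ suc c × FullClass a f p
  existsFullClass {n} {suc r} a a-sym a-irrefl c n≤rc rc<n+r with boundedColouring n (suc r) c n≤rc
  -- One more than the total of `a` is enough for any initial energy; the marked colour `zero` is
  -- arbitrary, as all classes are within `c`.
  ... | f , f≤c = improveToFull a a-sym a-irrefl c rc<n+r (suc (∑[ u < n ] sum (a u))) f zero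
    (m≤n⇒m≤1+n (f≤c zero) , λ i _ → f≤c i) (m≤n+m _ (energy a f))

  -- Ceilings and rational inequalities in terms of naturals.

  floor-spec : ∀ p → ∃[ m ] m < ℚ.↧ₙ p × ℚ.↥ p ≡ ℤ.+ m ℤ.+ ℚ.floor p ℤ.* ℚ.↧ p
  floor-spec p@record{} = ℚ.↥ p ℤ.% ℚ.↧ p , ℤ.n%d<d (ℚ.↥ p) (ℚ.↧ p) , ℤ.a≡a%n+[a/n]*n (ℚ.↥ p) (ℚ.↧ p)

  -- The ceiling is minus the floor of `- p`, so the remainder for `- p` becomes the excess `m` of
  -- rounding up.
  ceiling-spec : ∀ p → ∃[ m ] m < ℚ.↧ₙ p × ℚ.↥ p ℤ.+ ℤ.+ m ≡ ℚ.ceiling p ℤ.* ℚ.↧ p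
  ceiling-spec p with floor-spec (ℚ.- p)
  ... | m , m<d , eq = m , subst (m <_) (cong ℤ.∣_∣ (ℚ.↧-neg p)) m<d , (begin
    N ℤ.+ ℤ.+ m                                    ≡⟨ +-as-neg N (ℤ.+ m) ⟩
    ℤ.- (ℤ.- N ℤ.- ℤ.+ m)                          ≡⟨ cong (λ x → ℤ.- (x ℤ.- ℤ.+ m)) (trans (sym (ℚ.↥-neg p)) eq) ⟩
    ℤ.- (ℤ.+ m ℤ.+ F ℤ.* ℚ.↧ (ℚ.- p) ℤ.- ℤ.+ m)    ≡⟨ cancel (ℤ.+ m) F (ℚ.↧ (ℚ.- p)) ⟩
    ℤ.- F ℤ.* ℚ.↧ (ℚ.- p)                          ≡⟨ cong₂ ℤ._*_ (ceiling-def p) (ℚ.↧-neg p) ⟩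
    ℚ.ceiling p ℤ.* ℚ.↧ p                          ∎)
    where
    open ≡-Reasoning
    N = ℚ.↥ p
    F = ℚ.floor (ℚ.- p)
    ceiling-def : ∀ p → ℤ.- ℚ.floor (ℚ.- p) ≡ ℚ.ceiling p
    ceiling-def record{} = refl
    +-as-neg : ∀ x y → x ℤ.+ y ≡ ℤ.- (ℤ.- x ℤ.- y)
    +-as-neg = ℤSolver.solve-∀
    cancel : ∀ x y z → ℤ.- (x ℤ.+ y ℤ.* z ℤ.- x) ≡ ℤ.- y ℤ.* z
    cancel = ℤSolver.solve-∀

  -- `g` is the factor cancelled in reducing `n / r` to `p`. Scaling `ceiling-spec` by it gives
  -- `n + m * g` equal to `r` times the ceiling, with `m * g < r`; both bounds follow.
  ceiling-scaled : ∀ p g n r .{{_ : NonZero r}} → ℚ.↥ p ℤ.* ℤ.+ g ≡ ℤ.+ n → ℚ.↧ p ℤ.* ℤ.+ g ≡ ℤ.+ r →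
    ∃[ c ] ℤ.+ c ≡ ℚ.ceiling p × n ≤ r * c × r * c < n + r
  ceiling-scaled p zero n (suc r) _ d*0≡r = contradiction (trans (sym (ℤ.*-zeroʳ (ℚ.↧ p))) d*0≡r) λ ()
  ceiling-scaled p g@(suc _) n r@(suc _) num den with ceiling-spec p
  ... | m , m<d , eq = nonneg (ℚ.ceiling p) scaled
    where
    mg<r : m * g < r
    mg<r = subst (m * g <_) (ℤ.+-injective (trans (ℤ.pos-* (ℚ.↧ₙ p) g) den)) (*-monoˡ-< g m<d)
    scaled : ℤ.+ (n + m * g) ≡ ℚ.ceiling p ℤ.* ℤ.+ r
    scaled = begin
      ℤ.+ (n + m * g)                    ≡⟨ ℤ.pos-+ n (m * g) ⟩
      ℤ.+ n ℤ.+ ℤ.+ (m * g)              ≡⟨ cong₂ ℤ._+_ (sym num) (ℤ.pos-* m g) ⟩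
      ℚ.↥ p ℤ.* ℤ.+ g ℤ.+ ℤ.+ m ℤ.* ℤ.+ g  ≡⟨ sym (ℤ.*-distribʳ-+ (ℤ.+ g) (ℚ.↥ p) (ℤ.+ m)) ⟩
      (ℚ.↥ p ℤ.+ ℤ.+ m) ℤ.* ℤ.+ g        ≡⟨ cong (ℤ._* ℤ.+ g) eq ⟩
      ℚ.ceiling p ℤ.* ℚ.↧ p ℤ.* ℤ.+ g    ≡⟨ ℤ.*-assoc (ℚ.ceiling p) (ℚ.↧ p) (ℤ.+ g) ⟩
      ℚ.ceiling p ℤ.* (ℚ.↧ p ℤ.* ℤ.+ g)  ≡⟨ cong (ℚ.ceiling p ℤ.*_) den ⟩
      ℚ.ceiling p ℤ.* ℤ.+ r              ∎
      where open ≡-Reasoning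
    nonneg : ∀ z → ℤ.+ (n + m * g) ≡ z ℤ.* ℤ.+ r → ∃[ c ] ℤ.+ c ≡ z × n ≤ r * c × r * c < n + r
    nonneg (ℤ.+ c) eq′ = c , refl , subst (n ≤_) total (m≤m+n n (m * g)) , subst (_< n + r) total (+-monoʳ-< n mg<r)
      where
      total : n + m * g ≡ r * c
      total = trans (ℤ.+-injective (trans eq′ (sym (ℤ.pos-* c r)))) (*-comm c r)

  ceiling-/ : ∀ n r .{{_ : NonZero r}} →
    ∃[ c ] ℤ.+ c ≡ ℚ.ceiling (ℤ.+ n ℚ./ r) × n ≤ r * c × r * c < n + r
  ceiling-/ n r = ceiling-scaled (ℤ.+ n ℚ./ r) (gcd n r) n r (ℚ.↥-/ (ℤ.+ n) r) (ℚ.↧-/ (ℤ.+ n) r)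

  -- The order on unnormalised rationals is cross-multiplication, which turns the claim into
  -- `d ≤ r * h`.
  ratio-≤ : ∀ d h r .{{_ : NonZero r}} → d ≤ r * h → ℤ.+ h ℚ./ 1 ℚ.≥ (ℤ.1ℤ ℚ./ r) ℚ.* (ℤ.+ d ℚ./ 1)
  ratio-≤ d h (suc r) d≤rh = ℚ.toℚᵘ-cancel-≤ (begin
    ℚ.toℚᵘ (1/r ℚ.* d/1)           ≃⟨ ℚ.toℚᵘ-homo-* 1/r d/1 ⟩
    -- `mkℚᵘ` takes the denominator minus one: `r` here is the predecessor from the pattern, and 0
    -- stands for denominator 1.
    ℚ.toℚᵘ 1/r ℚᵘ.* ℚ.toℚᵘ d/1     ≃⟨ ℚᵘ.*-cong (ℚ.toℚᵘ-fromℚᵘ (ℚᵘ.mkℚᵘ ℤ.1ℤ r)) (ℚ.toℚᵘ-fromℚᵘ (ℚᵘ.mkℚᵘ (ℤ.+ d) 0)) ⟩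
    ℚᵘ.mkℚᵘ ℤ.1ℤ r ℚᵘ.* ℚᵘ.mkℚᵘ (ℤ.+ d) 0 ≤⟨ ℚᵘ.*≤* cross ⟩
    ℚᵘ.mkℚᵘ (ℤ.+ h) 0              ≃⟨ ℚᵘ.≃-sym (ℚ.toℚᵘ-fromℚᵘ (ℚᵘ.mkℚᵘ (ℤ.+ h) 0)) ⟩
    ℚ.toℚᵘ (ℤ.+ h ℚ./ 1)           ∎)
    where
    open ℚᵘ.≤-Reasoning
    1/r = ℤ.1ℤ ℚ./ suc r
    d/1 = ℤ.+ d ℚ./ 1
    cross : ℤ.1ℤ ℤ.* ℤ.+ d ℤ.* ℤ.1ℤ ℤ.≤ ℤ.+ h ℤ.* ℤ.+ (suc r * 1)
    cross = subst₂ ℤ._≤_ (sym (trans (ℤ.*-identityʳ _) (ℤ.*-identityˡ _)))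
      (trans (cong ℤ.+_ (trans (*-comm (suc r) h) (cong (h *_) (sym (*-identityʳ (suc r)))))) (ℤ.pos-* h (suc r * 1)))
      (ℤ.+≤+ d≤rh)

  -- Colour classes as subgraphs.

  count-tabulate : ∀ {n p} {A : Set} {P : A → Set p} (P? : ∀ x → Dec (P x)) (f : Vector A n) →
    Vec.count P? (Vec.tabulate f) ≡ ∑[ i < n ] 𝟙 (P? (f i))
  count-tabulate {zero}  P? f = refl
  count-tabulate {suc n} P? f with does (P? (f zero))
  ... | true  = cong suc (count-tabulate P? (f ∘ suc))
  ... | false = count-tabulate P? (f ∘ suc)

  class : ∀ {n r} → Colouring n r → Fin r → Subset n
  class f p = Vec.tabulate λ w → does (f w ≟ p)

  ∣class∣≡size : ∀ {n r} (f : Colouring n r) p → ∣ class f p ∣ ≡ size f p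
  ∣class∣≡size f p = trans (count-tabulate (Bool._≟ true) (λ w → does (f w ≟ p))) (sum-cong-≗ same)
    where
    same : ∀ w → 𝟙 (does (f w ≟ p) Bool.≟ true) ≡ 1 * 𝟙 (f w ≟ p)
    same w with f w ≟ p
    ... | yes _ = refl
    ... | no  _ = refl

  ∈class⁺ : ∀ {n r} (f : Colouring n r) {p v} → f v ≡ p → v ∈ class f p
  ∈class⁺ f {p} {v} fv≡p = lookup⇒[]= v _ (trans (lookup∘tabulate _ v) (dec-true (f v ≟ p) fv≡p))

  ∈class⁻ : ∀ {n r} (f : Colouring n r) {p v} → v ∈ class f p → f v ≡ p
  ∈class⁻ f {p} {v} v∈ with f v ≟ p | trans (sym (lookup∘tabulate (λ w → does (f w ≟ p)) v)) ([]=⇒lookup v∈)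
  ... | yes fv≡p | _ = fv≡p

  inducedByClass : ∀ {n r} (G : Graph n) → Colouring n r → Fin r → Subgraph G
  inducedByClass G f p = record
    { vertices = class f p
    ; Edge     = λ u v → Adj u v × f u ≡ p × f v ≡ p
    ; edge?    = λ u v → adj? u v ×-dec (f u ≟ p) ×-dec (f v ≟ p)
    ; sym      = λ (uv , fu , fv) → Graph.sym G uv , fv , fu
    ; edge⇒∈   = λ (_ , fu , _) → ∈class⁺ f fu
    ; edge⇒adj = proj₁
    }
    where open Graph G using (Adj; adj?)

  adjacency : ∀ {n} → Graph n → Fin n → Vector ℕ n
  adjacency G u w = 𝟙 (Graph.adj? G u w)

  adjacency-sym : ∀ {n} (G : Graph n) u w → adjacency G u w ≡ adjacency G w u
  adjacency-sym G u w = 𝟙-cong (Graph.adj? G u w) (Graph.adj? G w u) (Graph.sym G) (Graph.sym G)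

  adjacency-irrefl : ∀ {n} (G : Graph n) v → adjacency G v v ≡ 0
  adjacency-irrefl G v = 𝟙-no (Graph.adj? G v v) (Graph.irrefl G refl)

  degree≡sum : ∀ {n} (G : Graph n) v → Graph.degree G v ≡ sum (adjacency G v)
  degree≡sum G v = count-tabulate (Graph.adj? G v) id

  -- Taking the class of `v` itself makes the condition on the first endpoint true, leaving
  -- adjacency times membership of the other.
  degree-inducedByClass : ∀ {n r} (G : Graph n) (f : Colouring n r) v →
    Subgraph.degree (inducedByClass G f (f v)) v ≡ weight f (adjacency G v) (f v)
  degree-inducedByClass G f v = trans
    (count-tabulate (Subgraph.edge? (inducedByClass G f (f v)) v) id) (sum-cong-≗ same)
    where
    same : ∀ w → 𝟙 (Graph.adj? G v w ×-dec (f v ≟ f v) ×-dec (f w ≟ f v)) ≡ 𝟙 (Graph.adj? G v w) * 𝟙 (f w ≟ f v)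
    same w rewrite dec-true (f v ≟ f v) refl with does (Graph.adj? G v w) | does (f w ≟ f v)
    ... | false | _     = refl
    ... | true  | false = refl
    ... | true  | true  = refl

  -- The two inequalities say `n / r ≤ c < n / r + 1`, so `c` is the ceiling of `n / r`, expressed
  -- without division.
  fullSubgraph : ∀ {n} (G : Graph n) r .{{_ : NonZero r}} c → n ≤ r * c → r * c < n + r →
    Σ[ H ∈ Subgraph G ]
      (∀ {v} → v ∈ Subgraph.vertices H → Graph.degree G v ≤ r * Subgraph.degree H v) ×
      (Subgraph.order H ≡ c ⊎ Subgraph.order H ≡ suc c)
  fullSubgraph G r c n≤rc rc<n+r
    with existsFullClass (adjacency G) (adjacency-sym G) (adjacency-irrefl G) c n≤rc rc<n+r
  ... | f , p , c≤fp , fp≤1+c , full = inducedByClass G f p , relativelyFull , order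
    where
    H = inducedByClass G f p
    relativelyFull : ∀ {v} → v ∈ class f p → Graph.degree G v ≤ r * Subgraph.degree H v
    relativelyFull {v} v∈H with ∈class⁻ f v∈H
    ... | refl = subst₂ (λ d h → d ≤ r * h) (sym (degree≡sum G v)) (sym (degree-inducedByClass G f v)) (full v refl)
    order : Subgraph.order H ≡ c ⊎ Subgraph.order H ≡ suc c
    order rewrite ∣class∣≡size f p with m≤n⇒m<n∨m≡n fp≤1+c
    ... | inj₁ fp<1+c = inj₁ (≤-antisym (s≤s⁻¹ fp<1+c) c≤fp)
    ... | inj₂ fp≡1+c = inj₂ fp≡1+c

open Recolouring
open import Data.Integer.Base using (+_; 1ℤ; _+_)
open import Data.Rational.Base using (_/_; floor; ceiling)

theorem8 : (n : ℕ) (G : Graph n) (r : ℕ) .{{_ : NonZero r}} →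
  Σ[ H ∈ Subgraph G ]
    RelativelyFull (1ℤ / r) H ×
    (+ Subgraph.order H ≡ floor (+ n / r) ⊎
     + Subgraph.order H ≡ ceiling (+ n / r) ⊎
     + Subgraph.order H ≡ ceiling (+ n / r) + 1ℤ)
theorem8 n G r = fromCeiling (ceiling-/ n r)
  where
  fromCeiling : ∃[ c ] + c ≡ ceiling (+ n / r) × n ℕ.≤ r ℕ.* c × r ℕ.* c ℕ.< n ℕ.+ r → _
  fromCeiling (c , c≡⌈n/r⌉ , n≤rc , rc<n+r) =
    let H , full , order = fullSubgraph G r c n≤rc rc<n+r in
    H ,
    (λ {v} v∈H → ratio-≤ (Graph.degree G v) (Subgraph.degree H v) r (full v∈H)) ,
    inj₂ (Sum.map
      (λ order≡c → trans (cong +_ order≡c) c≡⌈n/r⌉)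
      (λ order≡1+c → trans (cong +_ (trans order≡1+c (+-comm 1 c))) (cong (_+ 1ℤ) c≡⌈n/r⌉))
      order)
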